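{- Every threshold tolerance graph is a pairwise compatibility graph.
   Context: All graphs are finite and simple. A graph $G=(V,E)$ is a threshold tolerance graph if there exist functions $g,t:V\to\mathbb{R}^+$ (positive reals) such that for all distinct $x,y\in V$, $\{x,y\}\in E$ if and only if $g(x)+g(y)\ge\min(t(x),t(y))$. A graph $G=(V,E)$ is a pairwise compatibility graph (PCG) if there exist a tree $T$ with non-negative real edge weights, whose set of leaves is exactly $V$, and two non-negative real numbers $d_{min}\le d_{max}$ such that for all distinct $u,v\in V$, $(u,v)\in E$ if and only if $d_{min}\le d_T(u,v)\le d_{max}$, where $d_T(u,v)$ is the sum of the weights of the edges on the unique path from $u$ to $v$ in $T$. -}

module Defs where

open import Data.Fin using (Fin)
open import Data.List using (List; []; _∷_; length)
open import Data.List.Relation.Unary.Unique.Propositional using (Unique)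
open import Data.Nat as ℕ using (ℕ)
import Data.Nat.Properties as ℕ
open import Data.Product using (Σ; ∃-syntax; _×_; _,_; proj₁)
open import Data.Rational as ℚ using (ℚ; 0ℚ; ½; ∣_∣)
import Data.Rational.Properties as ℚ
open import Algebra.Properties.Group ℚ.+-0-group using (⁻¹-involutive)
open import Data.Sum using (inj₁; inj₂)
open import Function.Bundles using (_⇔_)
open import Function.Definitions using (Injective)
open import Level using (0ℓ)
open import Relation.Binary.Construct.Closure.ReflexiveTransitive using (Star; ε; _◅_)
open import Relation.Binary.Core using (Rel)
open import Relation.Binary.Definitions using (Decidable; Irreflexive; Symmetric)
open import Relation.Binary.PropositionalEquality
open import Relation.Nullary using (¬_)

-- Real numbers: Cauchy sequences of rationals, with equality given by _≃_.

IsCauchy : (ℕ → ℚ) → Set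
IsCauchy s = ∀ e → 0ℚ ℚ.< e →
  ∃[ N ] (∀ m n → N ℕ.≤ m → N ℕ.≤ n → ∣ s m ℚ.- s n ∣ ℚ.< e)

record ℝ : Set where
  constructor mkℝ
  field
    seq    : ℕ → ℚ
    cauchy : IsCauchy seq

open ℝ public

fromℚ : ℚ → ℝ
fromℚ q .seq _ = q
fromℚ q .cauchy e 0<e = 0 , λ _ _ _ _ →
  subst (ℚ._< e) (sym (cong ∣_∣ (ℚ.+-inverseʳ q))) 0<e

0ℝ : ℝ
0ℝ = fromℚ 0ℚ

private
  half-pos : ∀ {e} → 0ℚ ℚ.< e → 0ℚ ℚ.< ½ ℚ.* e
  half-pos {e} 0<e = subst (ℚ._< ½ ℚ.* e) (ℚ.*-zeroʳ ½) (ℚ.*-monoʳ-<-pos ½ 0<e)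

  half+half : ∀ e → ½ ℚ.* e ℚ.+ ½ ℚ.* e ≡ e
  half+half e = trans (sym (ℚ.*-distribʳ-+ e ½ ½)) (ℚ.*-identityˡ e)

  +-interchange-sub : ∀ a b c d →
    (a ℚ.+ b) ℚ.- (c ℚ.+ d) ≡ (a ℚ.- c) ℚ.+ (b ℚ.- d)
  +-interchange-sub a b c d = begin
    (a ℚ.+ b) ℚ.- (c ℚ.+ d)               ≡⟨ cong ((a ℚ.+ b) ℚ.+_) (ℚ.neg-distrib-+ c d) ⟩
    (a ℚ.+ b) ℚ.+ (ℚ.- c ℚ.+ ℚ.- d)       ≡⟨ ℚ.+-assoc a b _ ⟩
    a ℚ.+ (b ℚ.+ (ℚ.- c ℚ.+ ℚ.- d))       ≡⟨ cong (a ℚ.+_) (ℚ.+-assoc b (ℚ.- c) (ℚ.- d)) ⟨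
    a ℚ.+ ((b ℚ.+ ℚ.- c) ℚ.+ ℚ.- d)       ≡⟨ cong (λ z → a ℚ.+ (z ℚ.+ ℚ.- d)) (ℚ.+-comm b (ℚ.- c)) ⟩
    a ℚ.+ ((ℚ.- c ℚ.+ b) ℚ.+ ℚ.- d)       ≡⟨ cong (a ℚ.+_) (ℚ.+-assoc (ℚ.- c) b (ℚ.- d)) ⟩
    a ℚ.+ (ℚ.- c ℚ.+ (b ℚ.+ ℚ.- d))       ≡⟨ ℚ.+-assoc a (ℚ.- c) _ ⟨
    (a ℚ.- c) ℚ.+ (b ℚ.- d)               ∎
    where open ≡-Reasoning

  neg-sub : ∀ p q → ℚ.- (p ℚ.- q) ≡ q ℚ.- p
  neg-sub p q = begin
    ℚ.- (p ℚ.- q)            ≡⟨ ℚ.neg-distrib-+ p (ℚ.- q) ⟩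
    ℚ.- p ℚ.+ ℚ.- (ℚ.- q)    ≡⟨ cong (ℚ.- p ℚ.+_) (⁻¹-involutive q) ⟩
    ℚ.- p ℚ.+ q              ≡⟨ ℚ.+-comm (ℚ.- p) q ⟩
    q ℚ.- p                  ∎
    where open ≡-Reasoning

  ∣sub∣-sym : ∀ p q → ∣ p ℚ.- q ∣ ≡ ∣ q ℚ.- p ∣
  ∣sub∣-sym p q = trans (sym (ℚ.∣-p∣≡∣p∣ (p ℚ.- q))) (cong ∣_∣ (neg-sub p q))

  p≤∣p∣ : ∀ p → p ℚ.≤ ∣ p ∣
  p≤∣p∣ p with ℚ.≤-total 0ℚ p
  ... | inj₁ 0≤p = ℚ.≤-reflexive (sym (ℚ.0≤p⇒∣p∣≡p 0≤p))
  ... | inj₂ p≤0 = ℚ.≤-trans p≤0 (ℚ.0≤∣p∣ p)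

  ⊓-sub-< : ∀ {e} a b c d → ∣ a ℚ.- c ∣ ℚ.< e → ∣ b ℚ.- d ∣ ℚ.< e →
            (a ℚ.⊓ b) ℚ.- (c ℚ.⊓ d) ℚ.< e
  ⊓-sub-< a b c d ac bd with ℚ.⊓-sel c d
  ... | inj₁ eq rewrite eq = ℚ.≤-<-trans
    (ℚ.≤-trans (ℚ.+-monoˡ-≤ (ℚ.- c) (ℚ.p⊓q≤p a b)) (p≤∣p∣ (a ℚ.- c))) ac
  ... | inj₂ eq rewrite eq = ℚ.≤-<-trans
    (ℚ.≤-trans (ℚ.+-monoˡ-≤ (ℚ.- d) (ℚ.p⊓q≤q a b)) (p≤∣p∣ (b ℚ.- d))) bd

  ∣⊓-sub∣-< : ∀ {e} a b c d → ∣ a ℚ.- c ∣ ℚ.< e → ∣ b ℚ.- d ∣ ℚ.< e →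
              ∣ (a ℚ.⊓ b) ℚ.- (c ℚ.⊓ d) ∣ ℚ.< e
  ∣⊓-sub∣-< {e} a b c d ac bd
    with ℚ.∣p∣≡p∨∣p∣≡-p ((a ℚ.⊓ b) ℚ.- (c ℚ.⊓ d))
  ... | inj₁ eq = subst (ℚ._< e) (sym eq) (⊓-sub-< a b c d ac bd)
  ... | inj₂ eq = subst (ℚ._< e)
    (sym (trans eq (neg-sub (a ℚ.⊓ b) (c ℚ.⊓ d))))
    (⊓-sub-< c d a b (subst (ℚ._< e) (∣sub∣-sym a c) ac)
                     (subst (ℚ._< e) (∣sub∣-sym b d) bd))

infixl 6 _+_
infixl 7 _⊓_
infix  4 _≤_ _<_ _≃_

_+_ : ℝ → ℝ → ℝ
(x + y) .seq n = seq x n ℚ.+ seq y n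
(x + y) .cauchy e 0<e with cauchy x (½ ℚ.* e) (half-pos 0<e)
                         | cauchy y (½ ℚ.* e) (half-pos 0<e)
... | M , hx | N , hy = M ℕ.⊔ N , λ m n m≥ n≥ →
  subst₂ ℚ._<_
    (cong ∣_∣ (sym (+-interchange-sub (seq x m) (seq y m) (seq x n) (seq y n))))
    (half+half e)
    (ℚ.≤-<-trans (ℚ.∣p+q∣≤∣p∣+∣q∣ (seq x m ℚ.- seq x n) (seq y m ℚ.- seq y n))
      (ℚ.+-mono-<
        (hx m n (ℕ.m⊔n≤o⇒m≤o M N m≥) (ℕ.m⊔n≤o⇒m≤o M N n≥))
        (hy m n (ℕ.m⊔n≤o⇒n≤o M N m≥) (ℕ.m⊔n≤o⇒n≤o M N n≥))))

_⊓_ : ℝ → ℝ → ℝ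
(x ⊓ y) .seq n = seq x n ℚ.⊓ seq y n
(x ⊓ y) .cauchy e 0<e with cauchy x e 0<e | cauchy y e 0<e
... | M , hx | N , hy = M ℕ.⊔ N , λ m n m≥ n≥ →
  ∣⊓-sub∣-< (seq x m) (seq y m) (seq x n) (seq y n)
    (hx m n (ℕ.m⊔n≤o⇒m≤o M N m≥) (ℕ.m⊔n≤o⇒m≤o M N n≥))
    (hy m n (ℕ.m⊔n≤o⇒n≤o M N m≥) (ℕ.m⊔n≤o⇒n≤o M N n≥))

_≤_ : Rel ℝ 0ℓ
x ≤ y = ∀ e → 0ℚ ℚ.< e → ∃[ N ] (∀ n → N ℕ.≤ n → seq x n ℚ.≤ seq y n ℚ.+ e)

_<_ : Rel ℝ 0ℓ
x < y = ∃[ e ] (0ℚ ℚ.< e × ∃[ N ] (∀ n → N ℕ.≤ n → seq x n ℚ.+ e ℚ.≤ seq y n))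

_≃_ : Rel ℝ 0ℓ
x ≃ y = x ≤ y × y ≤ x

-- Finite simple graphs on the vertex set Fin n. Decidability of adjacency is
-- what makes the edge set a finite set constructively; classically it is no
-- restriction.

record Graph (n : ℕ) : Set₁ where
  field
    Adj     : Rel (Fin n) 0ℓ
    adj?    : Decidable Adj
    symm    : Symmetric Adj
    irrefl  : Irreflexive _≡_ Adj

module _ {n : ℕ} (G : Graph n) where
  open Graph G

  Walk : Rel (Fin n) 0ℓ
  Walk = Star Adj

  vertices : ∀ {x y} → Walk x y → List (Fin n)
  vertices {x} ε       = x ∷ []
  vertices {x} (_ ◅ p) = x ∷ vertices p

  Path : Rel (Fin n) 0ℓ
  Path x y = Σ (Walk x y) λ p → Unique (vertices p)

  -- A cycle is a path on at least three vertices closed up by an edge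
  -- joining its endpoints.
  Cycle : Set
  Cycle = ∃[ x ] ∃[ y ] Σ (Path x y) λ p →
            3 ℕ.≤ length (vertices (proj₁ p)) × Adj y x

  -- Degree at most one. In a tree with at least two vertices this means
  -- degree exactly one; in the one-vertex tree, the vertex is a leaf.
  IsLeaf : Fin n → Set
  IsLeaf x = ∀ y z → Adj x y → Adj x z → y ≡ z

-- The empty graph counts as a tree; it has no leaves, so it is relevant only
-- to the pairwise compatibility of the empty graph.

record WeightedTree : Set₁ where
  field
    size      : ℕ
    graph     : Graph size
  open Graph graph public
  field
    connected       : ∀ x y → Path graph x y
    acyclic         : ¬ Cycle graph
    weight          : Fin size → Fin size → ℝ
    weight-symm     : ∀ {x y} → Adj x y → weight x y ≃ weight y x
    weight-nonneg   : ∀ {x y} → Adj x y → 0ℝ ≤ weight x y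

  walkWeight : ∀ {x y} → Walk graph x y → ℝ
  walkWeight ε                       = 0ℝ
  walkWeight (_◅_ {x} {y} _ p)       = weight x y + walkWeight p

  -- By acyclicity, connected x y is the only path from x to y.
  dist : Fin size → Fin size → ℝ
  dist x y = walkWeight (proj₁ (connected x y))

record IsThresholdTolerance {n : ℕ} (G : Graph n) : Set where
  open Graph G
  field
    g t    : Fin n → ℝ
    g-pos  : ∀ x → 0ℝ < g x
    t-pos  : ∀ x → 0ℝ < t x
    adj⇔   : ∀ x y → x ≢ y → Adj x y ⇔ t x ⊓ t y ≤ g x + g y

record IsPairwiseCompatibility {n : ℕ} (G : Graph n) : Set₁ where
  field
    tree : WeightedTree
  private
    module G = Graph G
    module T = WeightedTree tree
  field
    -- leaf identifies the vertices of G with the leaves of the tree.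
    leaf           : Fin n → Fin T.size
    leaf-injective : Injective _≡_ _≡_ leaf
    leaf-image     : ∀ x → IsLeaf T.graph x ⇔ (∃[ v ] leaf v ≡ x)
    dmin dmax      : ℝ
    dmin-nonneg    : 0ℝ ≤ dmin
    dmin≤dmax      : dmin ≤ dmax
    adj⇔           : ∀ u v → u ≢ v →
      G.Adj u v ⇔ (dmin ≤ T.dist (leaf u) (leaf v) × T.dist (leaf u) (leaf v) ≤ dmax)

{-# OPTIONS --safe #-}

-- With legs l = 2g - t attached to a line at the points p = t, the distance
-- l x + l y + ∣ p x - p y ∣ equals 2 (g x + g y - min (t x , t y)). Hence x and y
-- are adjacent iff this is at least 0, and a caterpillar with spine sorted by p
-- and all legs lengthened by a constant c is a pairwise compatibility tree,
-- for dmin = 2c and dmax large.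
--
-- Constructively, reals cannot be sorted, and nonadjacency gives no explicit gap
-- between g x + g y and min (t x , t y). But the gaps exist up to double negation, and
-- then so do rational l and p satisfying finitely many strict linear conditions.
-- Fourier–Motzkin elimination decides whether such rationals exist, which
-- removes the double negation.

module Submission where

open import Defs renaming
  (_+_ to _+ᵣ_; _⊓_ to _⊓ᵣ_; _≤_ to _≤ᵣ_; _<_ to _<ᵣ_; _≃_ to _≃ᵣ_)
open import Data.Empty using (⊥; ⊥-elim)
open import Data.Fin as Fin using (Fin; zero; suc; _↑ˡ_; _↑ʳ_)
open import Data.Fin.Permutation as Perm using (Permutation; permutation; _⟨$⟩ʳ_; _⟨$⟩ˡ_)
import Data.Fin.Properties as Fin
open import Data.List as List
  using (List; []; _∷_; _∷ʳ_; _++_; allFin; cartesianProductWith; concatMap; length)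
open import Data.List.Membership.Propositional using (_∈_)
open import Data.List.Membership.Propositional.Properties
  using (∈-allFin; ∈-cartesianProductWith⁺; ∈-cartesianProductWith⁻; ∈-lookup)
import Data.List.Properties as List
open import Data.List.Relation.Binary.Permutation.Propositional using (↭-sym; ↭⇒↭ₛ)
open import Data.List.Relation.Binary.Permutation.Propositional.Properties
  using (∈-resp-↭; ↭-length)
import Data.List.Relation.Binary.Permutation.Setoid.Properties as Permutationₛ
open import Data.List.Relation.Unary.All as All using (All; []; _∷_)
import Data.List.Relation.Unary.All.Properties as All
open import Data.List.Relation.Unary.AllPairs using ([]; _∷_)
open import Data.List.Relation.Unary.Any as Any using (Any; here; there)
import Data.List.Relation.Unary.Any.Properties as Any
import Data.List.Relation.Unary.Sorted.TotalOrder.Properties as Sorted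
open import Data.List.Relation.Unary.Unique.Propositional using (Unique)
import Data.List.Relation.Unary.Unique.Propositional.Properties as Unique
import Data.List.Sort as Sort
open import Data.Nat as ℕ using (ℕ; zero; suc)
import Data.Nat.Properties as ℕ
open import Data.Product using (Σ; Σ-syntax; ∃; ∃-syntax; _×_; _,_; proj₁; proj₂)
open import Data.Rational hiding (_≃_)
open import Data.Rational.Properties
open import Data.Sum as Sum using (_⊎_; inj₁; inj₂)
open import Data.Vec as Vec using (Vec; []; _∷_; lookup; replicate; zipWith)
import Data.Vec.Properties as Vec
open import Effect.Monad using (RawMonad)
open import Function.Base using (_∘_; id)
open import Function.Bundles using (_⇔_; mk⇔; Equivalence)
import Function.Properties.Equivalence as ⇔
open import Level using (0ℓ)
open import Relation.Binary.Bundles using (DecTotalOrder)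
open import Relation.Binary.Construct.Closure.ReflexiveTransitive using (ε; _◅_)
import Relation.Binary.Construct.On as On
open import Relation.Binary.Core using (Rel)
open import Relation.Binary.Definitions using (Tri; tri<; tri≈; tri>)
open import Relation.Binary.PropositionalEquality
open import Relation.Nullary using (¬_; Dec; yes; no)
open import Relation.Nullary.Decidable using (dec⇒maybe; decidable-stable; map′)
open import Relation.Nullary.Negation using (¬¬-Monad)
open import Tactic.RingSolver using (solve-∀)
open import Tactic.RingSolver.Core.AlmostCommutativeRing
  using (AlmostCommutativeRing; fromCommutativeRing)

open Equivalence using (to; from)

private variable
  m n : ℕ

-- Inequalities between rationals and density of their order

ℚ-ring : AlmostCommutativeRing _ _
ℚ-ring = fromCommutativeRing +-*-commutativeRing (λ q → dec⇒maybe (0ℚ ≟ q))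

-- The ring solver turns these two lemmas into a proof method for linear
-- inequalities: present the claim as a rearrangement of a known one.
≤-rearrange : ∀ {a b c d} → b - a ≡ d - c → a ≤ b → c ≤ d
≤-rearrange {a} {b} {c} {d} eq a≤b = subst₂ _≤_ (cancel a c)
  (trans (assoc b a c) (trans (cong (_+ c) eq) (cancel′ d c)))
  (+-monoˡ-≤ (c - a) a≤b)
  where
  cancel : ∀ a c → a + (c - a) ≡ c
  cancel = solve-∀ ℚ-ring
  cancel′ : ∀ d c → d - c + c ≡ d
  cancel′ = solve-∀ ℚ-ring
  assoc : ∀ b a c → b + (c - a) ≡ b - a + c
  assoc = solve-∀ ℚ-ring

<-rearrange : ∀ {a b c d} → b - a ≡ d - c → a < b → c < d
<-rearrange {a} {b} {c} {d} eq a<b =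
  ≰⇒> (λ d≤c → <-irrefl refl (<-≤-trans a<b (≤-rearrange swapped d≤c)))
  where
  neg-sub : ∀ p q → - (q - p) ≡ p - q
  neg-sub = solve-∀ ℚ-ring
  swapped : c - d ≡ a - b
  swapped = trans (sym (neg-sub c d)) (trans (cong -_ (sym eq)) (neg-sub a b))

p≤q⇒p≤q+e : ∀ {p q e} → p ≤ q → 0ℚ < e → p ≤ q + e
p≤q⇒p≤q+e {p} {q} {e} p≤q 0<e =
  ≤-trans p≤q (subst (_≤ q + e) (+-identityʳ q) (+-monoʳ-≤ q (<⇒≤ 0<e)))

-- Removes the arbitrary positive slack that `_≤ᵣ_` carries. If `q < p`, take `r` strictly between:
-- the slack `r - q` forces `p ≤ r`.
p≤q+e⇒p≤q : ∀ {p q} → (∀ e → 0ℚ < e → p ≤ q + e) → p ≤ q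
p≤q+e⇒p≤q {p} {q} h = ≮⇒≥ λ q<p → let r , q<r , r<p = <-dense q<p in
  <-irrefl refl (<-≤-trans r<p
    (≤-trans (h (r - q) (<-rearrange (eq₁ q r) q<r)) (≤-reflexive (eq₂ q r))))
  where
  eq₁ : ∀ q r → r - q ≡ r - q - 0ℚ
  eq₁ = solve-∀ ℚ-ring
  eq₂ : ∀ q r → q + (r - q) ≡ r
  eq₂ = solve-∀ ℚ-ring

∃-below : (qs : List ℚ) → ∃[ z ] All (z <_) qs
∃-below [] = 0ℚ , []
∃-below (q ∷ qs) with ∃-below qs
... | z , z<qs = (q - 1ℚ) ⊓ z ,
  ≤-<-trans (p⊓q≤p (q - 1ℚ) z) (<-rearrange (eq q) (positive⁻¹ 1ℚ)) ∷
  All.map (≤-<-trans (p⊓q≤q (q - 1ℚ) z)) z<qs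
  where
  eq : ∀ q → 1ℚ - 0ℚ ≡ q - (q - 1ℚ)
  eq = solve-∀ ℚ-ring

∃-between₁ : ∀ p (qs : List ℚ) → All (p <_) qs → ∃[ z ] (p < z × All (z <_) qs)
∃-between₁ p [] [] = p + 1ℚ , <-rearrange (eq p) (positive⁻¹ 1ℚ) , []
  where
  eq : ∀ p → 1ℚ - 0ℚ ≡ p + 1ℚ - p
  eq = solve-∀ ℚ-ring
∃-between₁ p (q ∷ qs) (p<q ∷ p<qs) with <-dense p<q | ∃-between₁ p qs p<qs
... | y , p<y , y<q | z , p<z , z<qs with ⊓-sel y z
...   | inj₁ eq = y , p<y , y<q ∷ All.map (≤-<-trans (p⊓q≡p⇒p≤q eq)) z<qs
...   | inj₂ eq = z , p<z , ≤-<-trans (p⊓q≡q⇒q≤p eq) y<q ∷ z<qs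

-- Density makes the elimination of an unknown exact. A point found for the remaining lower bounds
-- is kept if it exceeds `p`; otherwise `p` dominates those bounds, and any point between `p` and
-- `qs` will do.
∃-between : (ps qs : List ℚ) → All (λ p → All (p <_) qs) ps →
            ∃[ z ] (All (_< z) ps × All (z <_) qs)
∃-between [] qs [] with ∃-below qs
... | z , z<qs = z , [] , z<qs
∃-between (p ∷ ps) qs (p<qs ∷ ps<qs) with ∃-between ps qs ps<qs
... | z , ps<z , z<qs with p <? z
...   | yes p<z = z , p<z ∷ ps<z , z<qs
...   | no p≮z with ∃-between₁ p qs p<qs
...     | y , p<y , y<qs =
  y , p<y ∷ All.map (λ x<z → <-trans x<z (≤-<-trans (≮⇒≥ p≮z) p<y)) ps<z , y<qs

-- Linear systems over ℚ

infix 8 _∙_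

_∙_ : ∀ {m} → Vec ℚ m → Vec ℚ m → ℚ
[]       ∙ []       = 0ℚ
(a ∷ as) ∙ (v ∷ vs) = a * v + as ∙ vs

unit : ∀ {m} → Fin m → Vec ℚ m
unit zero    = 1ℚ ∷ replicate _ 0ℚ
unit (suc i) = 0ℚ ∷ unit i

infixl 6 _⊕_ _⊖_
infixl 7 _⊛_

_⊕_ _⊖_ : ∀ {m} → Vec ℚ m → Vec ℚ m → Vec ℚ m
_⊕_ = zipWith _+_
_⊖_ = zipWith _-_

_⊛_ : ∀ {m} → ℚ → Vec ℚ m → Vec ℚ m
c ⊛ as = Vec.map (c *_) as

∙-zero : (v : Vec ℚ m) → replicate m 0ℚ ∙ v ≡ 0ℚ
∙-zero []      = refl
∙-zero (x ∷ v) = trans (cong₂ _+_ (*-zeroˡ x) (∙-zero v)) (+-identityˡ 0ℚ)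

∙-unit : ∀ {m} i (v : Vec ℚ m) → unit i ∙ v ≡ lookup v i
∙-unit zero    (x ∷ v) = trans (cong₂ _+_ (*-identityˡ x) (∙-zero v)) (+-identityʳ x)
∙-unit (suc i) (x ∷ v) = trans (cong₂ _+_ (*-zeroˡ x) (∙-unit i v)) (+-identityˡ _)

∙-⊕ : (a b v : Vec ℚ m) → (a ⊕ b) ∙ v ≡ a ∙ v + b ∙ v
∙-⊕ []       []       []      = refl
∙-⊕ (a ∷ as) (b ∷ bs) (x ∷ v) =
  trans (cong ((a + b) * x +_) (∙-⊕ as bs v)) (distrib a b x (as ∙ v) (bs ∙ v))
  where
  distrib : ∀ a b x y z → (a + b) * x + (y + z) ≡ a * x + y + (b * x + z)
  distrib = solve-∀ ℚ-ring

∙-⊖ : (a b v : Vec ℚ m) → (a ⊖ b) ∙ v ≡ a ∙ v - b ∙ v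
∙-⊖ []       []       []      = refl
∙-⊖ (a ∷ as) (b ∷ bs) (x ∷ v) =
  trans (cong ((a - b) * x +_) (∙-⊖ as bs v)) (distrib a b x (as ∙ v) (bs ∙ v))
  where
  distrib : ∀ a b x y z → (a - b) * x + (y - z) ≡ a * x + y - (b * x + z)
  distrib = solve-∀ ℚ-ring

∙-⊛ : ∀ {m} c (a v : Vec ℚ m) → (c ⊛ a) ∙ v ≡ c * a ∙ v
∙-⊛ c []       []      = sym (*-zeroʳ c)
∙-⊛ c (a ∷ as) (x ∷ v) =
  trans (cong (c * a * x +_) (∙-⊛ c as v)) (distrib c a x (as ∙ v))
  where
  distrib : ∀ c a x y → c * a * x + c * y ≡ c * (a * x + y)
  distrib = solve-∀ ℚ-ring

-- Homogeneous strict inequalities suffice, because the conditions on `l` and `p` only concern signs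
-- of linear forms.
Solves : ∀ {m} → Vec ℚ m → List (Vec ℚ m) → Set
Solves v as = All (λ a → 0ℚ < a ∙ v) as

-- The inequalities sorted by the sign of their first coefficient and divided by it: positive gives
-- a lower bound on the first unknown, negative an upper bound, and zero an inequality in the other
-- unknowns.
record Isolation {m} (as : List (Vec ℚ (suc m))) : Set where
  field
    lower upper rest : List (Vec ℚ m)
    spec : ∀ x v → Solves (x ∷ v) as ⇔
      (All (λ b → b ∙ v < x) lower × All (λ c → x < c ∙ v) upper × Solves v rest)

open Isolation

isolate-head : ∀ {m} a .{{_ : NonZero a}} (as : Vec ℚ m) x v →
               (a ∷ as) ∙ (x ∷ v) ≡ a * (x - (- (1/ a) ⊛ as) ∙ v)
isolate-head a as x v = begin
  a * x + as ∙ v                             ≡⟨ cong (a * x +_) (*-identityˡ _) ⟨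
  a * x + 1ℚ * as ∙ v                        ≡⟨ cong (λ i → a * x + i * as ∙ v) (*-inverseʳ a) ⟨
  a * x + a * 1/ a * as ∙ v                  ≡⟨ factor a x (1/ a) (as ∙ v) ⟩
  a * (x - - (1/ a) * as ∙ v)                ≡⟨ cong (λ y → a * (x - y)) (∙-⊛ (- (1/ a)) as v) ⟨
  a * (x - (- (1/ a) ⊛ as) ∙ v)              ∎
  where
  open ≡-Reasoning
  factor : ∀ a x i y → a * x + a * i * y ≡ a * (x - - i * y)
  factor = solve-∀ ℚ-ring

0<pos*sub⇔> : ∀ a .{{_ : Positive a}} {x y} → 0ℚ < a * (x - y) ⇔ y < x
0<pos*sub⇔> a {x} {y} = mk⇔
  (λ h → <-rearrange (eq x y) (*-cancelˡ-<-nonNeg a {{pos⇒nonNeg a}}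
    (subst (_< a * (x - y)) (sym (*-zeroʳ a)) h)))
  (λ y<x → subst (_< a * (x - y)) (*-zeroʳ a) (*-monoʳ-<-pos a (<-rearrange (sym (eq x y)) y<x)))
  where
  eq : ∀ x y → x - y - 0ℚ ≡ x - y
  eq = solve-∀ ℚ-ring

0<neg*sub⇔< : ∀ a .{{_ : Negative a}} {x y} → 0ℚ < a * (x - y) ⇔ x < y
0<neg*sub⇔< a {x} {y} = mk⇔
  (λ h → <-rearrange (eq x y) (*-cancelˡ-<-nonPos a {{neg⇒nonPos a}}
    (subst (_< a * (x - y)) (sym (*-zeroʳ a)) h)))
  (λ x<y → subst (_< a * (x - y)) (*-zeroʳ a) (*-monoʳ-<-neg a (<-rearrange (sym (eq x y)) x<y)))
  where
  eq : ∀ x y → 0ℚ - (x - y) ≡ y - x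
  eq = solve-∀ ℚ-ring

isolate : (as : List (Vec ℚ (suc m))) → Isolation as
isolate [] = record { lower = [] ; upper = [] ; rest = []
                    ; spec = λ _ _ → mk⇔ (λ _ → [] , [] , []) (λ _ → []) }
isolate ((a ∷ as) ∷ ass) with isolate ass | <-cmp a 0ℚ
... | I | tri< a<0 _ _ = record
  { lower = lower I ; upper = (- (1/ a) ⊛ as) ∷ upper I ; rest = rest I
  ; spec = λ x v → mk⇔
      (λ { (h ∷ hs) → let L , U , R = to (spec I x v) hs in
           L , to (0<neg*sub⇔< a) (subst (0ℚ <_) (isolate-head a as x v) h) ∷ U , R })
      (λ { (L , u ∷ U , R) →
           subst (0ℚ <_) (sym (isolate-head a as x v)) (from (0<neg*sub⇔< a) u)
           ∷ from (spec I x v) (L , U , R) })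
  }
  where instance
    _ = negative a<0
    _ = neg⇒nonZero a
... | I | tri≈ _ refl _ = record
  { lower = lower I ; upper = upper I ; rest = as ∷ rest I
  ; spec = λ x v → mk⇔
      (λ { (h ∷ hs) → let L , U , R = to (spec I x v) hs in
           L , U , subst (0ℚ <_) (drop-head x (as ∙ v)) h ∷ R })
      (λ { (L , U , r ∷ R) →
           subst (0ℚ <_) (sym (drop-head x (as ∙ v))) r ∷ from (spec I x v) (L , U , R) })
  }
  where
  drop-head : ∀ x y → 0ℚ * x + y ≡ y
  drop-head = solve-∀ ℚ-ring
... | I | tri> _ _ a>0 = record
  { lower = (- (1/ a) ⊛ as) ∷ lower I ; upper = upper I ; rest = rest I
  ; spec = λ x v → mk⇔
      (λ { (h ∷ hs) → let L , U , R = to (spec I x v) hs in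
           to (0<pos*sub⇔> a) (subst (0ℚ <_) (isolate-head a as x v) h) ∷ L , U , R })
      (λ { (l ∷ L , U , R) →
           subst (0ℚ <_) (sym (isolate-head a as x v)) (from (0<pos*sub⇔> a) l)
           ∷ from (spec I x v) (L , U , R) })
  }
  where instance
    _ = positive a>0
    _ = pos⇒nonZero a

0<⊖⇔< : (c b v : Vec ℚ m) → 0ℚ < (c ⊖ b) ∙ v ⇔ b ∙ v < c ∙ v
0<⊖⇔< c b v = mk⇔ (<-rearrange eq) (<-rearrange (sym eq))
  where
  eq : (c ⊖ b) ∙ v - 0ℚ ≡ c ∙ v - b ∙ v
  eq = trans (+-identityʳ _) (∙-⊖ c b v)

-- Fourier–Motzkin elimination of the first unknown.
solvable? : (as : List (Vec ℚ m)) → Dec (∃[ v ] Solves v as)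
solvable? {zero}  []       = yes ([] , [])
-- With no unknowns left, every inequality reads 0 < 0.
solvable? {zero}  ([] ∷ _) = no λ { ([] , 0<0 ∷ _) → <-irrefl refl 0<0 }
solvable? {suc m} as = map′ extend restrict (solvable? (differences ++ rest I))
  where
  I = isolate as
  -- A value for the first unknown exists iff each lower bound is less than each upper bound. These
  -- conditions are again homogeneous and strict, so the elimination can continue.
  differences = cartesianProductWith _⊖_ (upper I) (lower I)

  extend : ∃[ v ] Solves v (differences ++ rest I) → ∃[ v ] Solves v as
  extend (v , sol) = z ∷ v ,
    from (spec I z v) (All.map⁻ L , All.map⁻ U , All.++⁻ʳ differences sol)
    where
    ordered : All (λ p → All (p <_) (List.map (_∙ v) (upper I)))
                  (List.map (_∙ v) (lower I))
    ordered = All.map⁺ (All.tabulate λ {b} b∈ → All.map⁺ (All.tabulate λ {c} c∈ →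
      to (0<⊖⇔< c b v)
         (All.lookup (All.++⁻ˡ differences sol) (∈-cartesianProductWith⁺ _⊖_ c∈ b∈))))
    between = ∃-between _ _ ordered
    z = proj₁ between
    L = proj₁ (proj₂ between)
    U = proj₂ (proj₂ between)

  restrict : ∃[ v ] Solves v as → ∃[ v ] Solves v (differences ++ rest I)
  restrict (x ∷ v , sol) with to (spec I x v) sol
  ... | L , U , R = v , All.++⁺ (All.tabulate positive-difference) R
    where
    positive-difference : ∀ {d} → d ∈ differences → 0ℚ < d ∙ v
    positive-difference d∈ with ∈-cartesianProductWith⁻ _⊖_ (upper I) (lower I) d∈
    ... | c , b , c∈ , b∈ , refl =
      from (0<⊖⇔< c b v) (<-trans (All.lookup L b∈) (All.lookup U c∈))

-- Conjunctions of disjunctions of linear inequalities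

SolvesCNF : ∀ {m} → Vec ℚ m → List (List (Vec ℚ m)) → Set
SolvesCNF v clauses = All (Any (λ a → 0ℚ < a ∙ v)) clauses

-- Disjunctions arise because a maximum of two linear forms is positive iff one of them is. The
-- search tries each alternative of each clause, collecting the chosen ones in `as`, and ends in a
-- plain linear system.
solvableCNF? : (clauses : List (List (Vec ℚ m))) → Dec (∃[ v ] SolvesCNF v clauses)
solvableCNF? clauses =
  map′ (λ { (v , _ , sol) → v , sol }) (λ { (v , sol) → v , [] , sol }) (go [] clauses)
  where
  go : ∀ (as : List (Vec ℚ m)) clauses →
       Dec (∃[ v ] (Solves v as × SolvesCNF v clauses))
  go as [] = map′ (λ { (v , sol) → v , sol , [] }) (λ { (v , sol , _) → v , sol }) (solvable? as)
  go {m} as (clause ∷ clauses) = map′ join split (branches clause)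
    where
    Branch : Vec ℚ m → Set
    Branch a = ∃[ v ] (Solves v (a ∷ as) × SolvesCNF v clauses)
    branches : (alternatives : List (Vec ℚ m)) → Dec (Any Branch alternatives)
    branches = Any.any? (λ a → go (a ∷ as) clauses)
    join : ∀ {alternatives} → Any Branch alternatives →
           ∃[ v ] (Solves v as × SolvesCNF v (alternatives ∷ clauses))
    join (here (v , h ∷ sol , cnf)) = v , sol , here h ∷ cnf
    join (there i) with join i
    ... | v , sol , c ∷ cnf = v , sol , there c ∷ cnf
    split : ∀ {alternatives} → ∃[ v ] (Solves v as × SolvesCNF v (alternatives ∷ clauses)) →
            Any Branch alternatives
    split (v , sol , here h ∷ cnf)  = here (v , h ∷ sol , cnf)
    split (v , sol , there c ∷ cnf) = there (split (v , sol , c ∷ cnf))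

-- Rational threshold tolerance representations

p≤∣p∣ : ∀ p → p ≤ ∣ p ∣
p≤∣p∣ p with ≤-total 0ℚ p
... | inj₁ 0≤p = ≤-reflexive (sym (0≤p⇒∣p∣≡p 0≤p))
... | inj₂ p≤0 = ≤-trans p≤0 (0≤∣p∣ p)

p⊓q≤r⇒p≤r⊎q≤r : ∀ p q {r} → p ⊓ q ≤ r → p ≤ r ⊎ q ≤ r
p⊓q≤r⇒p≤r⊎q≤r p q {r} h with ⊓-sel p q
... | inj₁ eq = inj₁ (subst (_≤ r) eq h)
... | inj₂ eq = inj₂ (subst (_≤ r) eq h)

half-pos : ∀ {e} → 0ℚ < e → 0ℚ < ½ * e
half-pos {e} 0<e = subst (_< ½ * e) (*-zeroʳ ½) (*-monoʳ-<-pos ½ 0<e)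

-- Rationals are compared at one index `K`, after which both sequences move by less than e/4. If `a`
-- exceeded `b` by more than e/2 there, the excess over e/2 would be a gap at all later indices,
-- contradicting `b≮a`. Otherwise the two drifts bring the difference to at most e.
≮⇒≥ᵣ : ∀ a b → ¬ (b <ᵣ a) → a ≤ᵣ b
≮⇒≥ᵣ a b b≮a e 0<e with cauchy a _ (half-pos (half-pos 0<e)) | cauchy b _ (half-pos (half-pos 0<e))
... | M , ha | N , hb = K , λ k K≤k → ≤-rearrange (eq₁ (seq a k) (seq a K) (seq b k) (seq b K) e)
    (+-mono-≤ (+-mono-≤ (a-close k K K≤k ℕ.≤-refl) (b-close K k ℕ.≤-refl K≤k)) aK≤bK+½e)
  where
  K = M ℕ.⊔ N
  a-close : ∀ i j → K ℕ.≤ i → K ℕ.≤ j → seq a i - seq a j ≤ ½ * (½ * e)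
  a-close i j K≤i K≤j = <⇒≤ (≤-<-trans (p≤∣p∣ _)
    (ha i j (ℕ.m⊔n≤o⇒m≤o M N K≤i) (ℕ.m⊔n≤o⇒m≤o M N K≤j)))
  b-close : ∀ i j → K ℕ.≤ i → K ℕ.≤ j → seq b i - seq b j ≤ ½ * (½ * e)
  b-close i j K≤i K≤j = <⇒≤ (≤-<-trans (p≤∣p∣ _)
    (hb i j (ℕ.m⊔n≤o⇒n≤o M N K≤i) (ℕ.m⊔n≤o⇒n≤o M N K≤j)))
  eq₁ : ∀ ak aK bk bK e →
    ½ * (½ * e) + ½ * (½ * e) + (bK + ½ * e) - (ak - aK + (bK - bk) + aK) ≡ bk + e - ak
  eq₁ = solve-∀ ℚ-ring
  eq₂ : ∀ aK bK e → aK - (bK + ½ * e) ≡ aK - bK - ½ * e - 0ℚ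
  eq₂ = solve-∀ ℚ-ring
  eq₃ : ∀ ak aK bk bK e →
    ½ * (½ * e) + ½ * (½ * e) - (aK - ak + (bk - bK)) ≡ ak - (bk + (aK - bK - ½ * e))
  eq₃ = solve-∀ ℚ-ring
  aK≤bK+½e : seq a K ≤ seq b K + ½ * e
  aK≤bK+½e = ≮⇒≥ λ bK+½e<aK → b≮a
    ( seq a K - seq b K - ½ * e
    , <-rearrange (eq₂ (seq a K) (seq b K) e) bK+½e<aK
    , K , λ k K≤k → ≤-rearrange (eq₃ (seq a k) (seq a K) (seq b k) (seq b K) e)
        (+-mono-≤ (a-close K k ℕ.≤-refl K≤k) (b-close k K K≤k ℕ.≤-refl)))

-- Uniform witnesses for finitely many conditions

module _ {A : Set} (_≼_ : Rel A 0ℓ) (bottom : A)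
         (_∨_ : A → A → A) (≼-∨ˡ : ∀ a b → a ≼ (a ∨ b)) (≼-∨ʳ : ∀ a b → b ≼ (a ∨ b))
  where

  -- Used for three orders: positive rationals with the order reversed and the minimum as join,
  -- indices in `ℕ`, and rationals with `_⊔_`.
  uniform : (P : Fin n → A → Set) → (∀ i {a b} → a ≼ b → P i a → P i b) →
            (∀ i → ∃ (P i)) → ∃[ a ] ∀ i → P i a
  uniform {zero}  P up h = bottom , λ ()
  uniform {suc n} P up h with h zero | uniform (P ∘ suc) (up ∘ suc) (h ∘ suc)
  ... | a , pa | b , pb = a ∨ b , λ where
    zero    → up zero (≼-∨ˡ a b) pa
    (suc i) → up (suc i) (≼-∨ʳ a b) (pb i)

  uniform₂ : (P : Fin n → Fin n → A → Set) → (∀ i j {a b} → a ≼ b → P i j a → P i j b) →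
             (∀ i j → ∃ (P i j)) → ∃[ a ] ∀ i j → P i j a
  uniform₂ P up h = uniform (λ i a → ∀ j → P i j a) (λ i a≼b p j → up i j a≼b (p j))
                      (λ i → uniform (P i) (up i) (h i))

ℚ⁺ : Set
ℚ⁺ = ∃[ e ] 0ℚ < e

⊓-pos : ∀ {a b} → 0ℚ < a → 0ℚ < b → 0ℚ < a ⊓ b
⊓-pos {a} {b} 0<a 0<b with ⊓-sel a b
... | inj₁ eq = subst (0ℚ <_) (sym eq) 0<a
... | inj₂ eq = subst (0ℚ <_) (sym eq) 0<b

uniform-ℚ⁺ : (P : Fin n → Fin n → ℚ → Set) → (∀ i j {a b} → b ≤ a → P i j a → P i j b) →
             (∀ i j → ∃[ e ] (0ℚ < e × P i j e)) → ∃[ e ] (0ℚ < e × ∀ i j → P i j e)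
uniform-ℚ⁺ P up h with uniform₂ (λ (a b : ℚ⁺) → proj₁ b ≤ proj₁ a) (1ℚ , positive⁻¹ 1ℚ) min
    (λ a b → p⊓q≤p (proj₁ a) (proj₁ b)) (λ a b → p⊓q≤q (proj₁ a) (proj₁ b))
    (λ i j e → P i j (proj₁ e)) (λ i j → up i j)
    (λ i j → let e , 0<e , p = h i j in (e , 0<e) , p)
  where
  min : ℚ⁺ → ℚ⁺ → ℚ⁺
  min (a , 0<a) (b , 0<b) = a ⊓ b , ⊓-pos 0<a 0<b
... | (e , 0<e) , p = e , 0<e , p

-- `P i j` need not be monotone in the index. The condition that it holds from some index on is, and
-- it is read off at its first index at the end.
eventually : (P : Fin n → Fin n → ℕ → Set) →
  (∀ i j → ∃[ N ] ∀ k → N ℕ.≤ k → P i j k) → ∃[ N ] ∀ i j → P i j N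
eventually P h with uniform₂ ℕ._≤_ 0 ℕ._⊔_ ℕ.m≤m⊔n ℕ.m≤n⊔m
    (λ i j N → ∀ k → N ℕ.≤ k → P i j k) (λ i j M≤N p k N≤k → p k (ℕ.≤-trans M≤N N≤k)) h
... | N , p = N , λ i j → p i j N ℕ.≤-refl

upper-bound : (f : Fin n → ℚ) → ∃[ b ] ∀ i → f i ≤ b
upper-bound f = uniform _≤_ 0ℚ _⊔_ p≤p⊔q p≤q⊔p
  (λ i b → f i ≤ b) (λ i a≤b fi≤a → ≤-trans fi≤a a≤b) (λ i → f i , ≤-refl)

-- The double-negation shift holds over a finite index set, so the gaps of all pairs may be assumed
-- at once.
¬¬-∀Fin : {P : Fin n → Set} → (∀ i → ¬ ¬ P i) → ¬ ¬ (∀ i → P i)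
¬¬-∀Fin = Fin.sequence (RawMonad.rawApplicative ¬¬-Monad)

-- l x + l y + ∣ p x - p y ∣ is the larger of signedLength l p x y and
-- signedLength l p y x; up to an additive constant, it will be the distance
-- between two leaves whose legs, of lengths l x and l y, are attached to a
-- line at the points p x and p y.
signedLength : (l p : Fin n → ℚ) → Fin n → Fin n → ℚ
signedLength l p x y = l x + l y + (p x - p y)

-- Strictness on both sides keeps every condition within the reach of `Solves`. Exchanging `x` and
-- `y` in `nonadjacent` also bounds the other signed length, hence the maximum of the two.
record Separates (G : Graph n) (l p : Fin n → ℚ) : Set where
  open Graph G
  field
    adjacent    : ∀ {x y} → x ≢ y → Adj x y →
                  0ℚ < signedLength l p x y ⊎ 0ℚ < signedLength l p y x
    nonadjacent : ∀ {x y} → x ≢ y → ¬ Adj x y → signedLength l p x y < 0ℚ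

open Separates

-- From a real representation to rational separation

module _ {G : Graph n} (tt : IsThresholdTolerance G) where
  open Graph G
  open IsThresholdTolerance tt

  Gap : Fin n → Fin n → Set
  Gap x y = x ≢ y → ¬ Adj x y → (g x +ᵣ g y) <ᵣ (t x ⊓ᵣ t y)

  -- Refuting the strict inequality yields the reverse non-strict one by `≮⇒≥ᵣ`, and that means
  -- adjacency.
  ¬¬gap : ∀ x y → ¬ ¬ Gap x y
  ¬¬gap x y ¬gap = ¬gap λ x≢y ¬adj → ⊥-elim (¬adj (from (adj⇔ x y x≢y)
    (≮⇒≥ᵣ (t x ⊓ᵣ t y) (g x +ᵣ g y) λ lt → ¬gap λ _ _ → lt)))

  gaps⇒separated : (∀ x y → Gap x y) → ∃[ l ] ∃[ p ] Separates G l p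
  gaps⇒separated gap = l , p , record { adjacent = adjacent′ ; nonadjacent = nonadjacent′ }
    where
    HasGap : Fin n → Fin n → ℚ → Set
    HasGap x y e = x ≢ y → ¬ Adj x y →
      ∃[ N ] ∀ k → N ℕ.≤ k → seq (g x) k + seq (g y) k + e ≤ seq (t x) k ⊓ seq (t y) k

    hasGap : ∀ x y → ∃[ e ] (0ℚ < e × HasGap x y e)
    hasGap x y with x Fin.≟ y | adj? x y
    -- Equal and adjacent pairs impose no gap; 1 is a placeholder.
    ... | yes x≡y | _ = 1ℚ , positive⁻¹ 1ℚ , λ x≢y → ⊥-elim (x≢y x≡y)
    ... | no _ | yes adj = 1ℚ , positive⁻¹ 1ℚ , λ _ ¬adj → ⊥-elim (¬adj adj)
    ... | no x≢y | no ¬adj = let e , 0<e , N , h = gap x y x≢y ¬adj in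
      e , 0<e , λ _ _ → N , h

    uniformGap : ∃[ e ] (0ℚ < e × ∀ x y → HasGap x y e)
    uniformGap = uniform-ℚ⁺ HasGap
      (λ x y {a} {b} b≤a h x≢y ¬adj → let N , le = h x≢y ¬adj in
        N , λ k N≤k → ≤-trans (+-monoʳ-≤ (seq (g x) k + seq (g y) k) b≤a) (le k N≤k))
      hasGap

    e = proj₁ uniformGap
    q = ½ * (½ * e)
    0<q = half-pos (half-pos (proj₁ (proj₂ uniformGap)))

    -- At a late index, adjacency gives its inequality only up to `q`, whereas the gap of a
    -- nonadjacent pair holds in full.
    Approximation : Fin n → Fin n → ℕ → Set
    Approximation x y k = x ≢ y →
      (Adj x y → seq (t x) k ⊓ seq (t y) k ≤ seq (g x) k + seq (g y) k + q) ×
      (¬ Adj x y → seq (g x) k + seq (g y) k + e ≤ seq (t x) k ⊓ seq (t y) k)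

    approximation : ∃[ N ] ∀ x y → Approximation x y N
    approximation = eventually Approximation approx
      where
      approx : ∀ x y → ∃[ N ] ∀ k → N ℕ.≤ k → Approximation x y k
      approx x y with x Fin.≟ y | adj? x y
      ... | yes x≡y | _ = 0 , λ _ _ x≢y → ⊥-elim (x≢y x≡y)
      ... | no x≢y | yes adj = let N , h = to (adj⇔ x y x≢y) adj q 0<q in
        N , λ k N≤k _ → (λ _ → h k N≤k) , λ ¬adj → ⊥-elim (¬adj adj)
      ... | no x≢y | no ¬adj = let N , h = proj₂ (proj₂ uniformGap) x y x≢y ¬adj in
        N , λ k N≤k _ → (λ adj → ⊥-elim (¬adj adj)) , λ _ → h k N≤k

    N = proj₁ approximation
    γ p l : Fin n → ℚ
    γ x = seq (g x) N
    p x = seq (t x) N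
    l x = (γ x + q) + (γ x + q) - p x

    -- The shift by q of γ leaves a slack of q for adjacent, and of e - 2q = 2q
    -- for nonadjacent pairs.
    adjacent′ : ∀ {x y} → x ≢ y → Adj x y →
                0ℚ < signedLength l p x y ⊎ 0ℚ < signedLength l p y x
    adjacent′ {x} {y} x≢y adj =
      Sum.[ inj₂ ∘ positive′ y x ∘ (λ h → subst (λ s → p x ≤ s + q) (+-comm (γ x) (γ y)) h)
          , inj₁ ∘ positive′ x y ]
        (p⊓q≤r⇒p≤r⊎q≤r (p x) (p y) (proj₁ (proj₂ approximation x y x≢y) adj))
      where
      eq₀ : ∀ a q → q - 0ℚ ≡ a + q - a
      eq₀ = solve-∀ ℚ-ring
      eq₁ : ∀ γx γy px py q → (γx + γy + q + q) + (γx + γy + q + q) - (py + py) ≡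
        ((γx + q) + (γx + q) - px) + ((γy + q) + (γy + q) - py) + (px - py) - 0ℚ
      eq₁ = solve-∀ ℚ-ring
      -- In `signedLength l p x y` the term `p x` cancels, leaving 2 (γ x + γ y + 2q) - 2 p y; the
      -- claim is twice `h′`.
      positive′ : ∀ x y → p y ≤ γ x + γ y + q → 0ℚ < signedLength l p x y
      positive′ x y h = <-rearrange (eq₁ (γ x) (γ y) (p x) (p y) q) (+-mono-< h′ h′)
        where
        h′ : p y < γ x + γ y + q + q
        h′ = ≤-<-trans h (<-rearrange (eq₀ (γ x + γ y + q) q) 0<q)

    nonadjacent′ : ∀ {x y} → x ≢ y → ¬ Adj x y → signedLength l p x y < 0ℚ
    nonadjacent′ {x} {y} x≢y ¬adj = <-rearrange (eq₁ (γ x) (γ y) (p x) (p y) e)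
        -- Two copies of `h` provide 2e = 8q, of which the shift of γ consumes 4q. The four copies
        -- of `0<q` are the remainder.
        (+-mono-≤-< (+-mono-≤ h h) (+-mono-< 0<q (+-mono-< 0<q (+-mono-< 0<q 0<q))))
      where
      h : γ x + γ y + e ≤ p y
      h = ≤-trans (proj₂ (proj₂ approximation x y x≢y) ¬adj) (p⊓q≤q (p x) (p y))
      eq₁ : ∀ γx γy px py e → let q = ½ * (½ * e) in
        (py + py) + (q + (q + (q + q))) - ((γx + γy + e) + (γx + γy + e) + (0ℚ + (0ℚ + (0ℚ + 0ℚ)))) ≡
        0ℚ - (((γx + q) + (γx + q) - px) + ((γy + q) + (γy + q) - py) + (px - py))
      eq₁ = solve-∀ ℚ-ring

  ¬¬separated : ¬ ¬ (∃[ l ] ∃[ p ] Separates G l p)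
  ¬¬separated ¬sep = ¬¬-∀Fin (λ x → ¬¬-∀Fin (¬¬gap x)) (¬sep ∘ gaps⇒separated)

-- Separation as a system of linear inequalities

All-concatMap-allFin : {A : Set} {P : A → Set} (f : Fin n → List A) →
  All P (concatMap f (allFin n)) ⇔ (∀ i → All P (f i))
All-concatMap-allFin f = mk⇔
  (λ h → All.tabulate⁻ (All.map⁻ (All.concat⁻ {xss = List.map f (allFin _)} h)))
  (λ h → All.concat⁺ (All.map⁺ (All.tabulate⁺ h)))

-- The unknowns are the n values of `l` followed by the n values of `p`; this is `signedLength` as a
-- linear form in them.
form : Fin n → Fin n → Vec ℚ (n ℕ.+ n)
form {n} x y = unit (x ↑ˡ n) ⊕ unit (y ↑ˡ n) ⊕ (unit (n ↑ʳ x) ⊖ unit (n ↑ʳ y))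

form-∙ : ∀ x y (v : Vec ℚ (n ℕ.+ n)) →
  form x y ∙ v ≡ signedLength (λ i → lookup v (i ↑ˡ n)) (λ i → lookup v (n ↑ʳ i)) x y
form-∙ {n} x y v =
  trans (∙-⊕ (unit (x ↑ˡ n) ⊕ unit (y ↑ˡ n)) (unit (n ↑ʳ x) ⊖ unit (n ↑ʳ y)) v)
    (cong₂ _+_
      (trans (∙-⊕ (unit (x ↑ˡ n)) (unit (y ↑ˡ n)) v)
        (cong₂ _+_ (∙-unit (x ↑ˡ n) v) (∙-unit (y ↑ˡ n) v)))
      (trans (∙-⊖ (unit (n ↑ʳ x)) (unit (n ↑ʳ y)) v)
        (cong₂ _-_ (∙-unit (n ↑ʳ x) v) (∙-unit (n ↑ʳ y) v))))

-1⊛-∙ : (a v : Vec ℚ m) → (- 1ℚ ⊛ a) ∙ v - 0ℚ ≡ 0ℚ - a ∙ v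
-1⊛-∙ a v = trans (cong (_- 0ℚ) (∙-⊛ (- 1ℚ) a v)) (eq (a ∙ v))
  where
  eq : ∀ b → - 1ℚ * b - 0ℚ ≡ 0ℚ - b
  eq = solve-∀ ℚ-ring

module _ (G : Graph n) where
  open Graph G

  clause : Fin n → Fin n → List (List (Vec ℚ (n ℕ.+ n)))
  clause x y with x Fin.≟ y | adj? x y
  ... | yes _ | _     = []
  ... | no _  | yes _ = (form x y ∷ form y x ∷ []) ∷ []
  ... | no _  | no _  = (- 1ℚ ⊛ form x y ∷ []) ∷ []

  clauses : List (List (Vec ℚ (n ℕ.+ n)))
  clauses = concatMap (λ x → concatMap (clause x) (allFin n)) (allFin n)

  separates⇒solvesCNF : ∀ {l p} → Separates G l p → ∃[ v ] SolvesCNF v clauses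
  separates⇒solvesCNF {l} {p} sep = v , from (All-concatMap-allFin _) λ x →
    from (All-concatMap-allFin (clause x)) λ y → solves x y
    where
    v : Vec ℚ (n ℕ.+ n)
    v = Vec.tabulate l Vec.++ Vec.tabulate p
    form-v : ∀ x y → form x y ∙ v ≡ signedLength l p x y
    form-v x y = trans (form-∙ x y v)
      (cong₂ _+_ (cong₂ _+_ (lookup-l x) (lookup-l y)) (cong₂ _-_ (lookup-p x) (lookup-p y)))
      where
      lookup-l : ∀ x → lookup v (x ↑ˡ n) ≡ l x
      lookup-l x = trans (Vec.lookup-++ˡ (Vec.tabulate l) (Vec.tabulate p) x)
                         (Vec.lookup∘tabulate l x)
      lookup-p : ∀ x → lookup v (n ↑ʳ x) ≡ p x
      lookup-p x = trans (Vec.lookup-++ʳ (Vec.tabulate l) (Vec.tabulate p) x)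
                         (Vec.lookup∘tabulate p x)
    solves : ∀ x y → SolvesCNF v (clause x y)
    solves x y with x Fin.≟ y | adj? x y
    ... | yes _  | _        = []
    ... | no x≢y | no ¬adj = here (<-rearrange (sym (-1⊛-∙ (form x y) v))
      (subst (_< 0ℚ) (sym (form-v x y)) (nonadjacent sep x≢y ¬adj))) ∷ []
    ... | no x≢y | yes adj with adjacent sep x≢y adj
    ...   | inj₁ h = here (subst (0ℚ <_) (sym (form-v x y)) h) ∷ []
    ...   | inj₂ h = there (here (subst (0ℚ <_) (sym (form-v y x)) h)) ∷ []

  solvesCNF⇒separates : ∀ v → SolvesCNF v clauses →
    Separates G (λ i → lookup v (i ↑ˡ n)) (λ i → lookup v (n ↑ʳ i))
  solvesCNF⇒separates v cnf = record
    { adjacent = λ {x} {y} x≢y adj → adjacent′ x y x≢y adj (solves x y)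
    ; nonadjacent = λ {x} {y} x≢y ¬adj → nonadjacent′ x y x≢y ¬adj (solves x y)
    }
    where
    l p : Fin n → ℚ
    l i = lookup v (i ↑ˡ n)
    p i = lookup v (n ↑ʳ i)
    solves : ∀ x y → SolvesCNF v (clause x y)
    solves x y = to (All-concatMap-allFin (clause x)) (to (All-concatMap-allFin _) cnf x) y
    adjacent′ : ∀ x y → x ≢ y → Adj x y → SolvesCNF v (clause x y) →
      0ℚ < signedLength l p x y ⊎ 0ℚ < signedLength l p y x
    adjacent′ x y x≢y adj h with x Fin.≟ y | adj? x y
    ... | yes x≡y | _ = ⊥-elim (x≢y x≡y)
    ... | no _ | no ¬adj = ⊥-elim (¬adj adj)
    adjacent′ x y x≢y adj (here h ∷ []) | no _ | yes _ = inj₁ (subst (0ℚ <_) (form-∙ x y v) h)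
    adjacent′ x y x≢y adj (there (here h) ∷ []) | no _ | yes _ =
      inj₂ (subst (0ℚ <_) (form-∙ y x v) h)
    nonadjacent′ : ∀ x y → x ≢ y → ¬ Adj x y → SolvesCNF v (clause x y) →
      signedLength l p x y < 0ℚ
    nonadjacent′ x y x≢y ¬adj h with x Fin.≟ y | adj? x y
    ... | yes x≡y | _ = ⊥-elim (x≢y x≡y)
    ... | no _ | yes adj = ⊥-elim (¬adj adj)
    nonadjacent′ x y x≢y ¬adj (here h ∷ []) | no _ | no _ =
      subst (_< 0ℚ) (form-∙ x y v) (<-rearrange (-1⊛-∙ (form x y) v) h)

  -- The clauses are computed from the graph alone, without the real functions `g` and `t`, which is
  -- what makes the question decidable.
  separated? : Dec (∃[ l ] ∃[ p ] Separates G l p)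
  separated? = map′ (λ { (v , cnf) → _ , _ , solvesCNF⇒separates v cnf })
                    (λ { (_ , _ , sep) → separates⇒solvesCNF sep })
                    (solvableCNF? clauses)

-- The tolerance representation only rules out that the search fails; the rationals themselves come
-- from the search.
separated : {G : Graph n} → IsThresholdTolerance G → ∃[ l ] ∃[ p ] Separates G l p
separated {G = G} tt = decidable-stable (separated? G) (¬¬separated tt)

-- Caterpillars

module _ (G : Graph n) where

  source∈vertices : ∀ {x y} (p : Walk G x y) → x ∈ vertices G p
  source∈vertices ε       = here refl
  source∈vertices (_ ◅ _) = here refl

  target∈vertices : ∀ {x y} (p : Walk G x y) → y ∈ vertices G p
  target∈vertices ε       = here refl
  target∈vertices (_ ◅ p) = there (target∈vertices p)

≤ᵣ-refl : ∀ r → r ≤ᵣ r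
≤ᵣ-refl r e 0<e = 0 , λ _ _ → p≤q⇒p≤q+e ≤-refl 0<e

zero∉map-suc : (xs : List (Fin n)) → All (Fin.zero ≢_) (List.map suc xs)
zero∉map-suc xs = All.map⁺ {P = Fin.zero ≢_} (All.tabulate {xs = xs} λ _ ())

-- Covers the empty and the one-vertex tree: the latter starts every caterpillar, and both serve
-- graphs with at most one vertex.
edgeless : (n : ℕ) → (∀ (x y : Fin n) → x ≡ y) → WeightedTree
edgeless n subsingleton = record
  { size          = n
  ; graph         = G
  ; connected     = λ x y → path (subsingleton x y)
  ; acyclic       = λ { (_ , _ , _ , _ , ()) }
  ; weight        = λ _ _ → 0ℝ
  ; weight-symm   = λ ()
  ; weight-nonneg = λ ()
  }
  where
  G : Graph n
  G = record { Adj = λ _ _ → ⊥ ; adj? = λ _ _ → no λ () ; symm = λ () ; irrefl = λ _ () }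
  path : ∀ {x y} → x ≡ y → Path G x y
  path refl = ε , [] ∷ []

-- The new vertex is zero, and the old vertices are shifted by suc.
module Pendant (T : WeightedTree) (v : Fin (WeightedTree.size T))
               (w : ℝ) (0≤w : 0ℝ ≤ᵣ w) where
  private module T = WeightedTree T

  Adj⁺ : Rel (Fin (suc T.size)) 0ℓ
  Adj⁺ zero    zero    = ⊥
  Adj⁺ zero    (suc y) = v ≡ y
  Adj⁺ (suc x) zero    = v ≡ x
  Adj⁺ (suc x) (suc y) = T.Adj x y

  graph⁺ : Graph (suc T.size)
  graph⁺ = record { Adj = Adj⁺ ; adj? = adj? ; symm = λ {x} {y} → symm x y ; irrefl = irrefl }
    where
    adj? : ∀ x y → Dec (Adj⁺ x y)
    adj? zero    zero    = no λ ()
    adj? zero    (suc y) = v Fin.≟ y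
    adj? (suc x) zero    = v Fin.≟ x
    adj? (suc x) (suc y) = T.adj? x y
    symm : ∀ x y → Adj⁺ x y → Adj⁺ y x
    symm zero    (suc y) a = a
    symm (suc x) zero    a = a
    symm (suc x) (suc y) a = T.symm a
    irrefl : ∀ {x y} → x ≡ y → ¬ Adj⁺ x y
    irrefl {suc x} refl a = T.irrefl refl a

  lift : ∀ {x y} → Walk T.graph x y → Walk graph⁺ (suc x) (suc y)
  lift ε       = ε
  lift (a ◅ p) = a ◅ lift p

  vertices-lift : ∀ {x y} (p : Walk T.graph x y) →
                  vertices graph⁺ (lift p) ≡ List.map suc (vertices T.graph p)
  vertices-lift ε       = refl
  vertices-lift (a ◅ p) = cong (_ ∷_) (vertices-lift p)

  lift-unique : ∀ {x y} (p : Path T.graph x y) → Unique (vertices graph⁺ (lift (proj₁ p)))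
  lift-unique (p , u) = subst Unique (sym (vertices-lift p)) (Unique.map⁺ Fin.suc-injective u)

  extend : ∀ {x} → Walk T.graph x v → Walk graph⁺ (suc x) zero
  extend ε       = refl ◅ ε
  extend (a ◅ p) = a ◅ extend p

  vertices-extend : ∀ {x} (p : Walk T.graph x v) →
                    vertices graph⁺ (extend p) ≡ List.map suc (vertices T.graph p) ∷ʳ zero
  vertices-extend ε       = refl
  vertices-extend (a ◅ p) = cong (_ ∷_) (vertices-extend p)

  connected⁺ : ∀ x y → Path graph⁺ x y
  connected⁺ zero zero = ε , [] ∷ []
  connected⁺ zero (suc y) = refl ◅ lift p ,
    subst (All (zero ≢_)) (sym (vertices-lift p)) (zero∉map-suc _) ∷ lift-unique (T.connected v y)
    where p = proj₁ (T.connected v y)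
  connected⁺ (suc x) zero = extend p , subst Unique (sym (vertices-extend p))
    (Unique.++⁺ (Unique.map⁺ Fin.suc-injective u) ([] ∷ [])
      λ { (z∈ , here refl) → All.lookup (zero∉map-suc (vertices T.graph p)) z∈ refl })
    where
    p = proj₁ (T.connected x v)
    u = proj₂ (T.connected x v)
  connected⁺ (suc x) (suc y) = lift (proj₁ (T.connected x y)) , lift-unique (T.connected x y)

  -- A walk without repetitions between old vertices avoids the new one,
  -- since it could enter and leave it only through v.
  restrict : ∀ {x y} (p : Walk graph⁺ (suc x) (suc y)) → Unique (vertices graph⁺ p) →
             Σ (Walk T.graph x y) λ q → vertices graph⁺ p ≡ List.map suc (vertices T.graph q)
  restrict ε _ = ε , refl
  restrict (_◅_ {j = suc z} a p) (_ ∷ u) with restrict p u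
  ... | q , eq = a ◅ q , cong (_ ∷_) eq
  restrict (_◅_ {j = zero} refl (_◅_ {j = suc z} refl p)) ((_ ∷ x∉p) ∷ _) =
    ⊥-elim (All.lookup x∉p (source∈vertices graph⁺ p) refl)

  -- The step that first reaches `zero` starts at `suc v`, its only neighbour.
  v∈vertices : ∀ {x} (p : Walk graph⁺ (suc x) zero) → suc v ∈ vertices graph⁺ p
  v∈vertices (_◅_ {j = zero} refl p) = here refl
  v∈vertices (_◅_ {j = suc z} a p)   = there (v∈vertices p)

  -- If an endpoint of the path is `zero`, both its neighbours on the cycle would be `suc v`, so the
  -- path is too short or repeats a vertex. Otherwise `restrict` turns the cycle into one of the old
  -- tree.
  acyclic⁺ : ¬ Cycle graph⁺
  acyclic⁺ (zero , suc y , (_◅_ {j = suc z} refl ε , _) , ℕ.s≤s (ℕ.s≤s ()) , refl)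
  acyclic⁺ (zero , suc y , (_◅_ {j = suc z} refl (b ◅ p) , _ ∷ (v∉p ∷ _)) , _ , refl) =
    All.lookup v∉p (target∈vertices graph⁺ p) refl
  acyclic⁺ (suc x , zero , (_◅_ {j = zero} a ε , _) , ℕ.s≤s (ℕ.s≤s ()) , _)
  acyclic⁺ (suc x , zero , (_◅_ {j = zero} a (b ◅ p) , _ ∷ (0∉p ∷ _)) , _ , _) =
    All.lookup 0∉p (target∈vertices graph⁺ p) refl
  acyclic⁺ (suc x , zero , (_◅_ {j = suc z} a p , x∉p ∷ _) , _ , refl) =
    All.lookup x∉p (v∈vertices p) refl
  acyclic⁺ (suc x , suc y , (p , u) , 3≤∣p∣ , a) with restrict p u
  ... | q , eq = T.acyclic (x , y , (q , Unique.map⁻ (subst Unique eq u)) ,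
    subst (3 ℕ.≤_) (trans (cong length eq) (List.length-map suc (vertices T.graph q))) 3≤∣p∣ , a)

  weight⁺ : Fin (suc T.size) → Fin (suc T.size) → ℝ
  weight⁺ zero    _       = w
  weight⁺ (suc x) zero    = w
  weight⁺ (suc x) (suc y) = T.weight x y

  tree : WeightedTree
  tree = record
    { size          = suc T.size
    ; graph         = graph⁺
    ; connected     = connected⁺
    ; acyclic       = acyclic⁺
    ; weight        = weight⁺
    ; weight-symm   = λ {x} {y} → weight-symm x y
    ; weight-nonneg = λ {x} {y} → weight-nonneg x y
    }
    where
    weight-symm : ∀ x y → Adj⁺ x y → weight⁺ x y ≃ᵣ weight⁺ y x
    weight-symm zero    (suc y) _ = ≤ᵣ-refl w , ≤ᵣ-refl w
    weight-symm (suc x) zero    _ = ≤ᵣ-refl w , ≤ᵣ-refl w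
    weight-symm (suc x) (suc y) a = T.weight-symm a
    weight-nonneg : ∀ x y → Adj⁺ x y → 0ℝ ≤ᵣ weight⁺ x y
    weight-nonneg zero    (suc y) _ = 0≤w
    weight-nonneg (suc x) zero    _ = 0≤w
    weight-nonneg (suc x) (suc y) a = T.weight-nonneg a

  private module T⁺ = WeightedTree tree

  walkWeight-lift : ∀ {x y} (p : Walk T.graph x y) k →
    seq (T⁺.walkWeight (lift p)) k ≡ seq (T.walkWeight p) k
  walkWeight-lift ε                 k = refl
  walkWeight-lift (_◅_ {x} {y} a p) k = cong (seq (T.weight x y) k +_) (walkWeight-lift p k)

  walkWeight-extend : ∀ {x} (p : Walk T.graph x v) k →
    seq (T⁺.walkWeight (extend p)) k ≡ seq (T.walkWeight p) k + seq w k
  walkWeight-extend ε       k = +-comm (seq w k) 0ℚ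
  walkWeight-extend (_◅_ {x} {y} a p) k =
    trans (cong (seq (T.weight x y) k +_) (walkWeight-extend p k))
          (sym (+-assoc (seq (T.weight x y) k) (seq (T.walkWeight p) k) (seq w k)))

  dist-old-old : ∀ x y k → seq (T⁺.dist (suc x) (suc y)) k ≡ seq (T.dist x y) k
  dist-old-old x y = walkWeight-lift (proj₁ (T.connected x y))

  dist-new-old : ∀ y k → seq (T⁺.dist zero (suc y)) k ≡ seq w k + seq (T.dist v y) k
  dist-new-old y k = cong (seq w k +_) (walkWeight-lift (proj₁ (T.connected v y)) k)

  dist-old-new : ∀ x k → seq (T⁺.dist (suc x) zero) k ≡ seq (T.dist x v) k + seq w k
  dist-old-new x = walkWeight-extend (proj₁ (T.connected x v))

fromℚ-mono-≤ : ∀ {a b} → a ≤ b → fromℚ a ≤ᵣ fromℚ b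
fromℚ-mono-≤ a≤b e 0<e = 0 , λ _ _ → p≤q⇒p≤q+e a≤b 0<e

record Profile (m : ℕ) : Set where
  field
    l p      : Fin (suc m) → ℚ
    l-nonneg : ∀ i → 0ℚ ≤ l i
    p-mono   : ∀ {i j} → i Fin.≤ j → p i ≤ p j

tail : ∀ {m} → Profile (suc m) → Profile m
tail π = record
  { l = l ∘ suc ; p = p ∘ suc ; l-nonneg = l-nonneg ∘ suc ; p-mono = p-mono ∘ ℕ.s≤s }
  where open Profile π

-- Vertex spine i lies at the point p i of a line, and carries a leg of
-- length l i ending in leaf i.
caterpillar : ∀ {m} → Profile m → WeightedTree
backbone    : ∀ {m} → Profile m → WeightedTree
tip         : (π : Profile m) → Fin (WeightedTree.size (backbone π))
spine leaf  : (π : Profile m) → Fin (suc m) → Fin (WeightedTree.size (caterpillar π))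
δ-nonneg    : (π : Profile (suc m)) → 0ℚ ≤ Profile.p π (suc zero) - Profile.p π zero

caterpillar π = Pendant.tree (backbone π) (tip π)
  (fromℚ (Profile.l π zero)) (fromℚ-mono-≤ (Profile.l-nonneg π zero))

backbone {zero}  π = edgeless 1 λ { zero zero → refl }
backbone {suc m} π = Pendant.tree (caterpillar (tail π)) (spine (tail π) zero)
  (fromℚ (Profile.p π (suc zero) - Profile.p π zero)) (fromℚ-mono-≤ (δ-nonneg π))

tip {zero}  π = zero
tip {suc m} π = zero

-- The spine vertex is added before its leaf. So the newest leaf is `zero`, the newest spine vertex
-- is `suc zero`, and older vertices are shifted by two.
leaf π zero            = zero
leaf {suc m} π (suc i) = suc (suc (leaf (tail π) i))

spine π zero            = suc (tip π)
spine {suc m} π (suc i) = suc (suc (spine (tail π) i))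

δ-nonneg π = ≤-rearrange (eq (Profile.p π zero) (Profile.p π (suc zero))) (Profile.p-mono π ℕ.z≤n)
  where
  eq : ∀ a b → b - a ≡ b - a - 0ℚ
  eq = solve-∀ ℚ-ring

-- All weights of a caterpillar are constant sequences, hence so are its distances, and comparing
-- them with rational bounds reduces to `ℚ`.
IsConst : ℝ → ℚ → Set
IsConst r q = ∀ k → seq r k ≡ q

module _ {m : ℕ} (π : Profile m) where
  open WeightedTree (caterpillar π) public using () renaming (dist to distance; Adj to Edge)

spine-leaf : ∀ (π : Profile m) i → Edge π (spine π i) (leaf π i)
spine-leaf π zero            = refl
spine-leaf {suc m} π (suc i) = spine-leaf (tail π) i

spine-spine : ∀ (π : Profile (suc m)) i → Edge π (spine π (Fin.inject₁ i)) (spine π (suc i))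
spine-spine π zero            = refl
spine-spine {suc m} π (suc i) = spine-spine (tail π) i

leaf≢spine : ∀ (π : Profile m) i j → leaf π i ≢ spine π j
leaf≢spine {suc m} π zero    (suc j) ()
leaf≢spine {suc m} π (suc i) (suc j) eq =
  leaf≢spine (tail π) i j (Fin.suc-injective (Fin.suc-injective eq))

leaf-injective : ∀ (π : Profile m) {i j} → leaf π i ≡ leaf π j → i ≡ j
leaf-injective π {zero} {zero} _ = refl
leaf-injective {suc m} π {zero} {suc j} ()
leaf-injective {suc m} π {suc i} {zero} ()
leaf-injective {suc m} π {suc i} {suc j} eq =
  cong suc (leaf-injective (tail π) (Fin.suc-injective (Fin.suc-injective eq)))

leaf-or-spine : ∀ (π : Profile m) x → (∃[ i ] leaf π i ≡ x) ⊎ (∃[ i ] spine π i ≡ x)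
leaf-or-spine π zero = inj₁ (zero , refl)
leaf-or-spine {zero} π (suc zero) = inj₂ (zero , refl)
leaf-or-spine {suc m} π (suc zero) = inj₂ (zero , refl)
leaf-or-spine {suc m} π (suc (suc x)) with leaf-or-spine (tail π) x
... | inj₁ (i , refl) = inj₁ (suc i , refl)
... | inj₂ (i , refl) = inj₂ (suc i , refl)

leaf-neighbour : ∀ (π : Profile m) i {y} → Edge π (leaf π i) y → y ≡ spine π i
leaf-neighbour π zero {suc y} refl = refl
leaf-neighbour {suc m} π (suc i) {suc zero} eq =
  ⊥-elim (leaf≢spine (tail π) i zero (sym eq))
leaf-neighbour {suc m} π (suc i) {suc (suc y)} a =
  cong (λ v → suc (suc v)) (leaf-neighbour (tail π) i a)

leaf-isLeaf : ∀ (π : Profile m) i → IsLeaf (WeightedTree.graph (caterpillar π)) (leaf π i)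
leaf-isLeaf π i y z a b = trans (leaf-neighbour π i a) (sym (leaf-neighbour π i b))

-- Besides its own leaf, a spine vertex has a spine neighbour: the next one for the first vertex,
-- the previous one for the others. A lone spine vertex would have degree one and be a leaf itself.
spine-notLeaf : ∀ (π : Profile (suc m)) i →
                ¬ IsLeaf (WeightedTree.graph (caterpillar π)) (spine π i)
spine-notLeaf π zero h =
  leaf≢spine π zero (suc zero)
  (h (leaf π zero) (spine π (suc zero)) (spine-leaf π zero) (spine-spine π zero))
spine-notLeaf π (suc i) h = leaf≢spine π (suc i) (Fin.inject₁ i)
  (h (leaf π (suc i)) (spine π (Fin.inject₁ i)) (spine-leaf π (suc i))
    (WeightedTree.symm (caterpillar π) {spine π (Fin.inject₁ i)} (spine-spine π i)))

isLeaf⇔leaf : ∀ (π : Profile (suc m)) x →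
              IsLeaf (WeightedTree.graph (caterpillar π)) x ⇔ (∃[ i ] leaf π i ≡ x)
isLeaf⇔leaf π x = mk⇔
  (λ h → Sum.fromInj₁ (λ x-spine → ⊥-elim (spine-x⇒notLeaf x-spine h)) (leaf-or-spine π x))
  (λ { (i , refl) → leaf-isLeaf π i })
  where
  spine-x⇒notLeaf : ∃[ i ] spine π i ≡ x → ¬ IsLeaf (WeightedTree.graph (caterpillar π)) x
  spine-x⇒notLeaf (i , refl) = spine-notLeaf π i

-- Distances in a caterpillar

module _ {m : ℕ} (π : Profile (suc m)) where
  open Profile π
  private
    module Leg  = Pendant (backbone π) (tip π) (fromℚ (l zero)) (fromℚ-mono-≤ (l-nonneg zero))
    module Link = Pendant (caterpillar (tail π)) (spine (tail π) zero)
                    (fromℚ (p (suc zero) - p zero)) (fromℚ-mono-≤ (δ-nonneg π))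

  distance-leaf-leaf : ∀ i j k →
    seq (distance π (leaf π (suc i)) (leaf π (suc j))) k ≡
    seq (distance (tail π) (leaf (tail π) i) (leaf (tail π) j)) k
  distance-leaf-leaf i j k =
    trans (Leg.dist-old-old (suc (leaf (tail π) i)) (suc (leaf (tail π) j)) k)
          (Link.dist-old-old (leaf (tail π) i) (leaf (tail π) j) k)

  distance-spine₀-leaf : ∀ j k →
    seq (distance π (spine π zero) (leaf π (suc j))) k ≡
    p (suc zero) - p zero + seq (distance (tail π) (spine (tail π) zero) (leaf (tail π) j)) k
  distance-spine₀-leaf j k =
    trans (Leg.dist-old-old zero (suc (leaf (tail π) j)) k) (Link.dist-new-old (leaf (tail π) j) k)

  distance-leaf-spine₀ : ∀ j k →
    seq (distance π (leaf π (suc j)) (spine π zero)) k ≡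
    seq (distance (tail π) (leaf (tail π) j) (spine (tail π) zero)) k + (p (suc zero) - p zero)
  distance-leaf-spine₀ j k =
    trans (Leg.dist-old-old (suc (leaf (tail π) j)) zero k) (Link.dist-old-new (leaf (tail π) j) k)

  distance-leaf₀-leaf : ∀ j k →
    seq (distance π (leaf π zero) (leaf π (suc j))) k ≡
    l zero + seq (distance π (spine π zero) (leaf π (suc j))) k
  distance-leaf₀-leaf j k = trans (Leg.dist-new-old (suc (leaf (tail π) j)) k)
    (cong (l zero +_) (sym (Leg.dist-old-old zero (suc (leaf (tail π) j)) k)))

  distance-leaf-leaf₀ : ∀ j k →
    seq (distance π (leaf π (suc j)) (leaf π zero)) k ≡
    seq (distance π (leaf π (suc j)) (spine π zero)) k + l zero
  distance-leaf-leaf₀ j k = trans (Leg.dist-old-new (suc (leaf (tail π) j)) k)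
    (cong (_+ l zero) (sym (Leg.dist-old-old (suc (leaf (tail π) j)) zero k)))

b+0≡a-a+b : ∀ a b → b + 0ℚ ≡ a - a + b
b+0≡a-a+b = solve-∀ ℚ-ring

-- The link lengths, being differences of consecutive values of `p`, telescope.
spine₀-leaf : ∀ (π : Profile m) j → let open Profile π in
  IsConst (distance π (spine π zero) (leaf π j)) (p j - p zero + l j)
spine₀-leaf {zero} π zero k = b+0≡a-a+b (Profile.p π zero) (Profile.l π zero)
spine₀-leaf {suc m} π zero k = b+0≡a-a+b (Profile.p π zero) (Profile.l π zero)
spine₀-leaf {suc m} π (suc j) k = trans (distance-spine₀-leaf π j k)
  (trans (cong (p (suc zero) - p zero +_) (spine₀-leaf (tail π) j k))
         (eq (p zero) (p (suc zero)) (p (suc j)) (l (suc j))))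
  where
  open Profile π
  eq : ∀ a b c d → b - a + (c - b + d) ≡ c - a + d
  eq = solve-∀ ℚ-ring

-- `dist` is read off the walk that `connected` chooses, separately for each direction, so the
-- reverse direction gets its own telescoping sum.
leaf-spine₀ : ∀ (π : Profile m) j → let open Profile π in
  IsConst (distance π (leaf π j) (spine π zero)) (p j - p zero + l j)
leaf-spine₀ {zero} π zero k = b+0≡a-a+b (Profile.p π zero) (Profile.l π zero)
leaf-spine₀ {suc m} π zero k = b+0≡a-a+b (Profile.p π zero) (Profile.l π zero)
leaf-spine₀ {suc m} π (suc j) k = trans (distance-leaf-spine₀ π j k)
  (trans (cong (_+ (p (suc zero) - p zero)) (leaf-spine₀ (tail π) j k))
         (eq (p zero) (p (suc zero)) (p (suc j)) (l (suc j))))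
  where
  open Profile π
  eq : ∀ a b c d → c - b + d + (b - a) ≡ c - a + d
  eq = solve-∀ ℚ-ring

-- Removing the entries before `i` changes no distance, so `i` may be taken to be `zero`. The path
-- is then a leg, a stretch of spine and another leg.
leaf-leaf : ∀ (π : Profile m) {i j} → i Fin.< j → let open Profile π in
  IsConst (distance π (leaf π i) (leaf π j)) (signedLength l p j i) ×
  IsConst (distance π (leaf π j) (leaf π i)) (signedLength l p j i)
leaf-leaf {suc m} π {zero} {suc j} _ =
    (λ k → trans (distance-leaf₀-leaf π j k)
      (trans (cong (l zero +_) (spine₀-leaf π (suc j) k))
             (eq₁ (l zero) (l (suc j)) (p zero) (p (suc j)))))
  , (λ k → trans (distance-leaf-leaf₀ π j k)
      (trans (cong (_+ l zero) (leaf-spine₀ π (suc j) k))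
             (eq₂ (l zero) (l (suc j)) (p zero) (p (suc j)))))
  where
  open Profile π
  eq₁ : ∀ a b c d → a + (d - c + b) ≡ b + a + (d - c)
  eq₁ = solve-∀ ℚ-ring
  eq₂ : ∀ a b c d → d - c + b + a ≡ b + a + (d - c)
  eq₂ = solve-∀ ℚ-ring
leaf-leaf {suc m} π {suc i} {suc j} (ℕ.s≤s i<j) =
  let h₁ , h₂ = leaf-leaf (tail π) i<j in
    (λ k → trans (distance-leaf-leaf π i j k) (h₁ k))
  , (λ k → trans (distance-leaf-leaf π j i k) (h₂ k))

-- Pairwise compatibility

lookup-injective : {A : Set} {xs : List A} → Unique xs →
                   ∀ {i j} → List.lookup xs i ≡ List.lookup xs j → i ≡ j
lookup-injective (_ ∷ _)   {zero}  {zero}  _  = refl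
lookup-injective (x∉ ∷ _)  {zero}  {suc j} eq = ⊥-elim (All.lookup x∉ (∈-lookup j) eq)
lookup-injective (x∉ ∷ _)  {suc i} {zero}  eq = ⊥-elim (All.lookup x∉ (∈-lookup i) (sym eq))
lookup-injective (_ ∷ xs!) {suc i} {suc j} eq = cong suc (lookup-injective xs! eq)

-- Sorting `allFin n` by `p` gives a list containing each vertex exactly once, so looking up
-- positions is a bijection, monotone by sortedness. `cast-domain` is there because the length of
-- the list is `n` only up to a proof.
sortingPermutation : (p : Fin n → ℚ) → Σ[ π ∈ Permutation n n ]
  (∀ {i j} → i Fin.≤ j → p (π ⟨$⟩ʳ i) ≤ p (π ⟨$⟩ʳ j))
sortingPermutation {n} p = cast-domain (trans (↭-length xs↭) (List.length-tabulate id))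
  ( permutation (List.lookup xs) (λ i → Any.index (i∈xs i))
      (λ i → sym (Any.lookup-index (i∈xs i)))
      (λ k → lookup-injective unique (sym (Any.lookup-index (i∈xs (List.lookup xs k)))))
  , Sorted.lookup-mono-≤ (DecTotalOrder.totalOrder byValue) (sort-↗ (allFin n)))
  where
  byValue : DecTotalOrder _ _ _
  byValue = On.decTotalOrder ≤-decTotalOrder p
  open Sort byValue using (sort; sort-↭; sort-↗)
  xs = sort (allFin n)
  xs↭ = sort-↭ (allFin n)
  i∈xs : ∀ i → i ∈ xs
  i∈xs i = ∈-resp-↭ (↭-sym xs↭) (∈-allFin i)
  unique = Permutationₛ.Unique-resp-↭ (setoid (Fin n)) (↭⇒↭ₛ (↭-sym xs↭)) (Unique.allFin⁺ n)
  Sorting : ℕ → Set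
  Sorting k = Σ[ π ∈ Permutation k n ] (∀ {i j} → i Fin.≤ j → p (π ⟨$⟩ʳ i) ≤ p (π ⟨$⟩ʳ j))
  cast-domain : ∀ {k} → k ≡ n → Sorting k → Sorting n
  cast-domain refl s = s

relabel : Permutation n n → Graph n → Graph n
relabel π G = record
  { Adj = λ x y → Adj (π ⟨$⟩ʳ x) (π ⟨$⟩ʳ y) ; adj? = λ x y → adj? (π ⟨$⟩ʳ x) (π ⟨$⟩ʳ y)
  ; symm = symm ; irrefl = λ { refl → irrefl refl } }
  where open Graph G

perm-injective : ∀ (π : Permutation n n) {i j : Fin n} → π ⟨$⟩ʳ i ≡ π ⟨$⟩ʳ j → i ≡ j
perm-injective π eq = trans (sym (Perm.inverseˡ π)) (trans (cong (π ⟨$⟩ˡ_) eq) (Perm.inverseˡ π))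

relabel-separates : ∀ (π : Permutation n n) {G : Graph n} {l p : Fin n → ℚ} → Separates G l p →
  Separates (relabel π G) (l ∘ (π ⟨$⟩ʳ_)) (p ∘ (π ⟨$⟩ʳ_))
relabel-separates π sep = record
  { adjacent    = λ x≢y → adjacent sep (x≢y ∘ perm-injective π)
  ; nonadjacent = λ x≢y → nonadjacent sep (x≢y ∘ perm-injective π) }

-- Tree and bounds stay the same; a vertex takes the leaf of its preimage under `π`.
relabel-pairwiseCompatible : ∀ (π : Permutation n n) {G : Graph n} →
  IsPairwiseCompatibility (relabel π G) → IsPairwiseCompatibility G
relabel-pairwiseCompatible π {G} pc = record
  { tree           = tree
  ; leaf           = leaf′
  ; leaf-injective = λ {u} {v} eq → trans (sym (Perm.inverseʳ π))
      (trans (cong (π ⟨$⟩ʳ_) (PC.leaf-injective eq)) (Perm.inverseʳ π))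
  ; leaf-image     = λ x → mk⇔
      (λ h → let i , eq = to (PC.leaf-image x) h in
        π ⟨$⟩ʳ i , trans (cong PC.leaf (Perm.inverseˡ π)) eq)
      (λ { (v , eq) → from (PC.leaf-image x) (π ⟨$⟩ˡ v , eq) })
  ; dmin           = PC.dmin
  ; dmax           = PC.dmax
  ; dmin-nonneg    = PC.dmin-nonneg
  ; dmin≤dmax      = PC.dmin≤dmax
  ; adj⇔           = λ u v u≢v →
      let h = PC.adj⇔ (π ⟨$⟩ˡ u) (π ⟨$⟩ˡ v) (λ eq → u≢v
                (trans (sym (Perm.inverseʳ π)) (trans (cong (π ⟨$⟩ʳ_) eq) (Perm.inverseʳ π))))
      in mk⇔ (λ a → to h (subst₂ Adj (sym (Perm.inverseʳ π)) (sym (Perm.inverseʳ π)) a))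
             (λ d → subst₂ Adj (Perm.inverseʳ π) (Perm.inverseʳ π) (from h d))
  }
  where
  module PC = IsPairwiseCompatibility pc
  open PC using (tree)
  open Graph G
  leaf′ : Fin _ → Fin (WeightedTree.size tree)
  leaf′ v = PC.leaf (π ⟨$⟩ˡ v)

-- Every vertex of the edgeless tree has degree zero and is a leaf, and there are no distinct pairs
-- to compare.
subsingleton-pairwiseCompatible : (∀ (x y : Fin n) → x ≡ y) →
                                  (G : Graph n) → IsPairwiseCompatibility G
subsingleton-pairwiseCompatible {n} subsingleton G = record
  { tree           = edgeless n subsingleton
  ; leaf           = id
  ; leaf-injective = id
  ; leaf-image     = λ x → mk⇔ (λ _ → x , refl) (λ _ _ _ ())
  ; dmin           = 0ℝ
  ; dmax           = 0ℝ
  ; dmin-nonneg    = ≤ᵣ-refl 0ℝ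
  ; dmin≤dmax      = ≤ᵣ-refl 0ℝ
  ; adj⇔           = λ u v u≢v → ⊥-elim (u≢v (subsingleton u v))
  }

module _ {r : ℝ} {q : ℚ} (r≡q : IsConst r q) where

  fromℚ≤const⁻ : ∀ {a} → fromℚ a ≤ᵣ r → a ≤ q
  fromℚ≤const⁻ {a} h = p≤q+e⇒p≤q λ e 0<e → let N , le = h e 0<e in
    subst (λ s → a ≤ s + e) (r≡q N) (le N ℕ.≤-refl)

  fromℚ≤const⁺ : ∀ {a} → a ≤ q → fromℚ a ≤ᵣ r
  fromℚ≤const⁺ {a} a≤q e 0<e = 0 , λ k _ →
    subst (λ s → a ≤ s + e) (sym (r≡q k)) (p≤q⇒p≤q+e a≤q 0<e)

  const≤fromℚ : ∀ {b} → q ≤ b → r ≤ᵣ fromℚ b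
  const≤fromℚ {b} q≤b e 0<e = 0 , λ k _ →
    subst (_≤ b + e) (sym (r≡q k)) (p≤q⇒p≤q+e q≤b 0<e)

module _ {m : ℕ} {G : Graph (suc (suc m))} {l p : Fin (suc (suc m)) → ℚ}
         (sep : Separates G l p) (p-mono : ∀ {i j} → i Fin.≤ j → p i ≤ p j) where
  open Graph G

  private
    L = signedLength l p

    -- Lengthening every leg by c makes all weights nonnegative.
    c = 0ℚ ⊔ proj₁ (upper-bound (-_ ∘ l))

    0≤c : 0ℚ ≤ c
    0≤c = p≤p⊔q 0ℚ (proj₁ (upper-bound (-_ ∘ l)))

    l+c-nonneg : ∀ i → 0ℚ ≤ l i + c
    l+c-nonneg i = ≤-rearrange (eq (l i) c)
      (≤-trans (proj₂ (upper-bound (-_ ∘ l)) i) (p≤q⊔p 0ℚ _))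
      where
      eq : ∀ a c → c - - a ≡ a + c - 0ℚ
      eq = solve-∀ ℚ-ring

    profile : Profile (suc m)
    profile = record { l = λ i → l i + c ; p = p ; l-nonneg = l+c-nonneg ; p-mono = p-mono }

    L⁺ : Fin (suc (suc m)) → Fin (suc (suc m)) → ℚ
    L⁺ = signedLength (λ i → l i + c) p

    rowBound : ∀ x → ∃[ b ] ∀ y → L⁺ x y ≤ b
    rowBound x = upper-bound (L⁺ x)

    bound : ∃[ b ] ∀ x → proj₁ (rowBound x) ≤ b
    bound = upper-bound (proj₁ ∘ rowBound)

    dmin dmax : ℚ
    dmin = c + c
    -- Above every leaf distance; the join with `dmin` secures `dmin ≤ dmax`.
    dmax = dmin ⊔ proj₁ bound

    L⁺≤dmax : ∀ x y → L⁺ x y ≤ dmax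
    L⁺≤dmax x y = ≤-trans (proj₂ (rowBound x) y)
      (≤-trans (proj₂ bound x) (p≤q⊔p dmin (proj₁ bound)))

    L⁺-L : ∀ x y → L x y - 0ℚ ≡ L⁺ x y - dmin
    L⁺-L x y = eq (l x) (l y) (p x - p y) c
      where
      eq : ∀ a b d c → a + b + d - 0ℚ ≡ a + c + (b + c) + d - (c + c)
      eq = solve-∀ ℚ-ring

    -- As `p` is sorted, `L j i` is the larger of the two signed lengths, so its sign decides
    -- adjacency. Lengthening both legs by `c` moves the threshold from 0 to `dmin`.
    adjacent⇔dmin≤ : ∀ {i j} → i Fin.< j → Adj i j ⇔ dmin ≤ L⁺ j i
    adjacent⇔dmin≤ {i} {j} i<j = mk⇔
      (λ a → ≤-rearrange (L⁺-L j i) (<⇒≤ (0<L (adjacent sep i≢j a))))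
      (λ le → decidable-stable (adj? i j) λ ¬a → <-irrefl refl
        (<-≤-trans (nonadjacent sep (i≢j ∘ sym) (¬a ∘ symm))
                   (≤-rearrange (sym (L⁺-L j i)) le)))
      where
      i≢j : i ≢ j
      i≢j = Fin.<⇒≢ i<j
      eq : ∀ a b s t → t + t - (s + s) ≡ b + a + (t - s) - (a + b + (s - t))
      eq = solve-∀ ℚ-ring
      0<L : 0ℚ < L i j ⊎ 0ℚ < L j i → 0ℚ < L j i
      -- `L j i` exceeds `L i j` by 2 (p j - p i), which is nonnegative.
      0<L (inj₁ h) = <-≤-trans h (≤-rearrange (eq (l i) (l j) (p i) (p j))
        (+-mono-≤ (p-mono (ℕ.<⇒≤ i<j)) (p-mono (ℕ.<⇒≤ i<j))))
      0<L (inj₂ h) = h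

    adjacent⇔distance : ∀ {i j} r → i Fin.< j → IsConst r (L⁺ j i) →
                        Adj i j ⇔ (fromℚ dmin ≤ᵣ r × r ≤ᵣ fromℚ dmax)
    adjacent⇔distance {i} {j} r i<j r≡ = mk⇔
      (λ a → fromℚ≤const⁺ {r} r≡ (to (adjacent⇔dmin≤ i<j) a)
           , const≤fromℚ {r} r≡ (L⁺≤dmax j i))
      (λ { (h , _) → from (adjacent⇔dmin≤ i<j) (fromℚ≤const⁻ {r} r≡ h) })

    d : Fin (suc (suc m)) → Fin (suc (suc m)) → ℝ
    d u v = distance profile (leaf profile u) (leaf profile v)

    adj⇔ : ∀ u v → u ≢ v → Adj u v ⇔ (fromℚ dmin ≤ᵣ d u v × d u v ≤ᵣ fromℚ dmax)
    adj⇔ u v u≢v = compare (Fin.<-cmp u v)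
      where
      compare : Tri (u Fin.< v) (u ≡ v) (v Fin.< u) →
                Adj u v ⇔ (fromℚ dmin ≤ᵣ d u v × d u v ≤ᵣ fromℚ dmax)
      compare (tri< u<v _ _) = adjacent⇔distance (d u v) u<v (proj₁ (leaf-leaf profile u<v))
      compare (tri≈ _ u≡v _) = ⊥-elim (u≢v u≡v)
      compare (tri> _ _ v<u) = ⇔.trans (mk⇔ symm symm)
        (adjacent⇔distance (d u v) v<u (proj₂ (leaf-leaf profile v<u)))

  separated⇒pairwiseCompatible : IsPairwiseCompatibility G
  separated⇒pairwiseCompatible = record
    { tree           = caterpillar profile
    ; leaf           = leaf profile
    ; leaf-injective = leaf-injective profile
    ; leaf-image     = isLeaf⇔leaf profile
    ; dmin           = fromℚ dmin
    ; dmax           = fromℚ dmax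
    ; dmin-nonneg    = fromℚ-mono-≤ (+-mono-≤ 0≤c 0≤c)
    ; dmin≤dmax      = fromℚ-mono-≤ (p≤p⊔q dmin (proj₁ bound))
    ; adj⇔           = adj⇔
    }

theorem3 : (n : ℕ) (G : Graph n) → IsThresholdTolerance G → IsPairwiseCompatibility G
theorem3 0 G _ = subsingleton-pairwiseCompatible (λ ()) G
theorem3 1 G _ = subsingleton-pairwiseCompatible (λ { zero zero → refl }) G
theorem3 (suc (suc m)) G tt =
  let l , p , sep = separated tt
      π , p-mono  = sortingPermutation p
  in relabel-pairwiseCompatible π (separated⇒pairwiseCompatible (relabel-separates π sep) p-mono)
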